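{- Let $X$ be a set and let $R$ be a topology expander over $X$. Then the least fixed point $\mu\tau.\,R(\tau)$ of $R$ (which exists since the topologies on $X$ form a complete lattice under inclusion and $R$ is monotone) is a Noetherian topology on $X$.
   Context: A topological space is Noetherian if every subset is compact; equivalently, every increasing sequence $(U_i)_{i\in\mathbb N}$ of open sets satisfies $\bigcup_{i\in\mathbb N}U_i=\bigcup_{i\le j}U_i$ for some $j$. A topology $\tau$ is Noetherian if $(X,\tau)$ is. A refinement function over a set $X$ is a map $R$ from topologies on $X$ to topologies on $X$ such that (i) $\tau\subseteq\tau'$ implies $R(\tau)\subseteq R(\tau')$, and (ii) $R(\tau)$ is Noetherian whenever $\tau$ is. For a topology $\tau$ on $X$ and a subset $H\subseteq X$ (typically closed), the subset restriction $\tau|_H$ is the topology on $X$ generated by the sets $U\cap H$ for $U\in\tau$. A topology expander is a refinement function $R$ such that for every Noetherian topology $\tau$ with $\tau\subseteq R(\tau)$ and every set $H$ closed in $\tau$, one has $R(\tau)|_H = R(\tau|_H)|_H$. -}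

module Defs where

open import Level using (Level; suc)
open import Data.List.Relation.Unary.Any using (Any)
open import Data.Product.Base using (_×_; ∃-syntax)
open import Data.Unit.Polymorphic.Base using (⊤)
open import Relation.Binary.Definitions using (_Respects_)
open import Relation.Unary using (Pred; _∈_; _⊆_; _≐_; _∩_; ∁; ⋃)

private
  variable
    ℓ : Level
    X : Set ℓ

-- Subsets of X are predicates, compared up to extensional equality _≐_; this
-- is why openness is required to respect _≐_.
--
-- Families of subsets are indexed by types in Set ℓ.  In the presence of
-- excluded middle this is no restriction: every subset of X is then
-- extensionally equal to the truth set of a map X → Bool, and X → Bool is in
-- Set ℓ, so every collection of subsets is enumerated, up to _≐_, by such a
-- family.
record Topology (X : Set ℓ) : Set (suc (suc ℓ)) where
  field
    Open   : Pred (Pred X ℓ) (suc ℓ)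
    resp   : Open Respects _≐_
    whole  : Open (λ _ → ⊤)
    inter  : ∀ {A B} → Open A → Open B → Open (A ∩ B)
    union  : (I : Set ℓ) (F : I → Pred X ℓ) → (∀ i → Open (F i)) → Open (⋃ I F)

  Closed : Pred (Pred X ℓ) (suc ℓ)
  Closed H = Open (∁ H)

open Topology public using (Open; Closed)

infix 4 _⊑_ _≈_

_⊑_ : Topology X → Topology X → Set _
τ ⊑ τ′ = Open τ ⊆ Open τ′

_≈_ : Topology X → Topology X → Set _
τ ≈ τ′ = Open τ ≐ Open τ′

Compact : {X : Set ℓ} → Topology X → Pred X ℓ → Set (suc ℓ)
Compact {ℓ} {X} τ K =
  (I : Set ℓ) (F : I → Pred X ℓ) → (∀ i → Open τ (F i)) → K ⊆ ⋃ I F →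
  ∃[ is ] K ⊆ (λ x → Any (λ i → x ∈ F i) is)

Noetherian : {X : Set ℓ} → Topology X → Set (suc ℓ)
Noetherian {ℓ} {X} τ = (K : Pred X ℓ) → Compact τ K

data GeneratedOpen {X : Set ℓ} (𝓑 : Pred (Pred X ℓ) (suc ℓ)) : Pred (Pred X ℓ) (suc ℓ) where
  basic : ∀ {A} → A ∈ 𝓑 → GeneratedOpen 𝓑 A
  resp  : GeneratedOpen 𝓑 Respects _≐_
  whole : GeneratedOpen 𝓑 (λ _ → ⊤)
  inter : ∀ {A B} → GeneratedOpen 𝓑 A → GeneratedOpen 𝓑 B → GeneratedOpen 𝓑 (A ∩ B)
  union : (I : Set ℓ) (F : I → Pred X ℓ) → (∀ i → GeneratedOpen 𝓑 (F i)) →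
          GeneratedOpen 𝓑 (⋃ I F)

generated : {X : Set ℓ} → Pred (Pred X ℓ) (suc ℓ) → Topology X
generated 𝓑 = record
  { Open  = GeneratedOpen 𝓑
  ; resp  = resp
  ; whole = whole
  ; inter = inter
  ; union = union
  }

infixl 6 _∣_

-- The restriction to H is still a topology on all of X.
_∣_ : {X : Set ℓ} → Topology X → Pred X ℓ → Topology X
τ ∣ H = generated (λ A → ∃[ V ] Open τ V × A ≐ V ∩ H)

record IsRefinementFunction {X : Set ℓ} (R : Topology X → Topology X) : Set (suc (suc ℓ)) where
  field
    monotone   : ∀ τ τ′ → τ ⊑ τ′ → R τ ⊑ R τ′
    noetherian : ∀ τ → Noetherian τ → Noetherian (R τ)

record IsTopologyExpander {X : Set ℓ} (R : Topology X → Topology X) : Set (suc (suc ℓ)) where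
  field
    isRefinementFunction : IsRefinementFunction R
    restriction : ∀ τ → Noetherian τ → τ ⊑ R τ → ∀ H → Closed τ H →
                  R τ ∣ H ≈ R (τ ∣ H) ∣ H

  open IsRefinementFunction isRefinementFunction public

record IsLeastFixedPoint {X : Set ℓ} (R : Topology X → Topology X) (μ : Topology X)
       : Set (suc (suc ℓ)) where
  field
    fixed : R μ ≈ μ
    least : ∀ σ → R σ ≈ σ → μ ⊑ σ

{-# OPTIONS --safe #-}

-- The least fixed point is the top of the transfinite iteration of R from the
-- coarsest topology.  That iteration is described without ordinals, as the
-- least class of topologies closed under R and under suprema: it is linearly
-- ordered, and each member is Noetherian by induction.
--
-- Only suprema need an argument, a topological minimal bad sequence.  Call an
-- open set V bad if the supremum is not Noetherian on ∁ V.  If the supremum is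
-- not Noetherian, there are stages τ₀ ⊑ τ₁ ⊑ … and sets V₀ ⊊ V₁ ⊊ … such that
-- Vₙ is maximal among the bad sets open in τₙ, and Vₙ₊₁ is open in R τₙ.  By
-- maximality the topology σ generated by the sets W ∩ ∁ Vₙ, with W open in τₙ,
-- is Noetherian, hence so is R σ.  As R is an expander, Vₙ₊₁ agrees on ∁ Vₙ
-- with a set Wₙ open in R σ, and Wₙ ∩ ∁ Vₙ is disjoint from the earlier Wₘ, which
-- is impossible in a Noetherian topology.
module Submission where

open import Defs
open import Axiom.ExcludedMiddle using (ExcludedMiddle)
open import Data.Bool.Base using (Bool; true; false)
open import Data.Empty using (⊥-elim)
open import Data.Empty.Polymorphic using (⊥)
open import Data.List.Base using (List; []; _∷_; _++_; map)
open import Data.List.Relation.Unary.Any as Any using (Any; here; there)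
open import Data.List.Relation.Unary.Any.Properties using (++⁺ˡ; ++⁺ʳ; map⁺)
open import Data.Nat.Base as ℕ using (ℕ; _≤_; _<_; s≤s; z≤n)
open import Data.Nat.ListAction using (sum)
open import Data.Nat.Properties
  using (≤-trans; <⇒≤; ≰⇒>; m≤m+n; m≤n+m; m≤n⇒m<n∨m≡n; ≤-pred; ≤-total; _≤?_)
open import Data.Product.Base using (Σ; _×_; _,_; proj₁; proj₂; ∃-syntax)
open import Data.Sum.Base using (_⊎_; inj₁; inj₂; [_,_]′)
open import Data.Unit.Polymorphic.Base using (tt)
open import Function.Base using (id; _∘_)
open import Level using (Level; Lift; lift; lower; _⊔_)
  renaming (suc to lsuc)
open import Relation.Binary.PropositionalEquality.Core using (_≡_; refl)
open import Relation.Nullary.Decidable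
  using (Dec; yes; no; True; toWitness; fromWitness; decidable-stable)
open import Relation.Nullary.Negation.Core using (¬_)
open import Relation.Unary using (Pred; _∈_; _∉_; _⊆_; _⊈_; _≐_; _∩_; _∪_; ∁; ⋃; U)

private
  variable
    a b ℓ : Level
    X : Set ℓ

-- Open sets and relative Noetherianity.

≐-refl : {A : Pred X a} → A ≐ A
≐-refl = id , id

∪-open : (τ : Topology X) {A B : Pred X _} → Open τ A → Open τ B → Open τ (A ∪ B)
∪-open {ℓ} {X} τ {A} {B} oA oB =
  Topology.resp τ
    ( (λ { (lift true , x∈A) → inj₁ x∈A ; (lift false , x∈B) → inj₂ x∈B })
    , [ lift true ,_ , lift false ,_ ]′ )
    (Topology.union τ (Lift ℓ Bool) F λ { (lift true) → oA ; (lift false) → oB })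
  where
  F : Lift ℓ Bool → Pred X ℓ
  F (lift true)  = A
  F (lift false) = B

∅-open : {X : Set ℓ} (τ : Topology X) → Open τ (λ _ → ⊥)
∅-open τ = Topology.resp τ ((λ { (() , _) }) , λ ()) (Topology.union τ ⊥ (λ ()) (λ ()))

⊑-noetherian : (σ τ : Topology X) → σ ⊑ τ → Noetherian τ → Noetherian σ
⊑-noetherian σ τ σ⊑τ noeth K I F oF = noeth K I F (λ i → σ⊑τ (oF i))

-- The family need not cover `S`: the finite subfamily has to reach only those points of `S` that
-- the whole family reaches. The collection `𝓑` may be a mere basis.
NoetherianOn : {X : Set ℓ} → Pred (Pred X ℓ) a → Pred X b → Set (lsuc ℓ ⊔ a ⊔ b)
NoetherianOn {ℓ} {X = X} 𝓑 S =
  (I : Set ℓ) (F : I → Pred X ℓ) → (∀ i → F i ∈ 𝓑) →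
  ∃[ is ] (∀ {x} → x ∈ S → ∀ i → x ∈ F i → Any (λ j → x ∈ F j) is)

noetherianOn : (τ : Topology X) → Noetherian τ → NoetherianOn (Open τ) U
noetherianOn τ noeth I F oF =
  let is , cover = noeth (⋃ I F) I F oF id
  in  is , λ _ i x∈F → cover (i , x∈F)

-- Generated topologies and restrictions.

generated-⊑ : {𝓑 : Pred (Pred X _) _} (τ : Topology X) → 𝓑 ⊆ Open τ → generated 𝓑 ⊑ τ
generated-⊑ τ 𝓑⊆τ (basic A∈𝓑)    = 𝓑⊆τ A∈𝓑
generated-⊑ τ 𝓑⊆τ (resp A≐B o)   = Topology.resp τ A≐B (generated-⊑ τ 𝓑⊆τ o)
generated-⊑ τ 𝓑⊆τ whole          = Topology.whole τ
generated-⊑ τ 𝓑⊆τ (inter o o′)   = Topology.inter τ (generated-⊑ τ 𝓑⊆τ o) (generated-⊑ τ 𝓑⊆τ o′)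
generated-⊑ τ 𝓑⊆τ (union I F oF) = Topology.union τ I F (λ i → generated-⊑ τ 𝓑⊆τ (oF i))

-- The whole space need not be a union of members of 𝓑, hence the first case.
generated-local :
  {𝓑 : Pred (Pred X _) _} → (∀ {A B} → A ∈ 𝓑 → B ∈ 𝓑 → (A ∩ B) ∈ 𝓑) →
  ∀ {A} → GeneratedOpen 𝓑 A → ∀ {x} → x ∈ A →
  (∀ y → y ∈ A) ⊎ (∃[ B ] (B ∈ 𝓑 × x ∈ B × B ⊆ A))
generated-local ∩-closed (basic A∈𝓑) x∈A = inj₂ (_ , A∈𝓑 , x∈A , id)
generated-local ∩-closed (resp (A⊆B , B⊆A) o) x∈B with generated-local ∩-closed o (B⊆A x∈B)
... | inj₁ all                   = inj₁ (λ y → A⊆B (all y))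
... | inj₂ (C , C∈𝓑 , x∈C , C⊆A) = inj₂ (C , C∈𝓑 , x∈C , λ y∈C → A⊆B (C⊆A y∈C))
generated-local ∩-closed whole _ = inj₁ (λ _ → tt)
generated-local ∩-closed (inter o o′) (x∈A , x∈A′)
  with generated-local ∩-closed o x∈A | generated-local ∩-closed o′ x∈A′
... | inj₁ all | inj₁ all′ = inj₁ (λ y → all y , all′ y)
... | inj₁ all | inj₂ (B , B∈𝓑 , x∈B , B⊆A′) =
  inj₂ (B , B∈𝓑 , x∈B , λ y∈B → all _ , B⊆A′ y∈B)
... | inj₂ (B , B∈𝓑 , x∈B , B⊆A) | inj₁ all′ =
  inj₂ (B , B∈𝓑 , x∈B , λ y∈B → B⊆A y∈B , all′ _)
... | inj₂ (B , B∈𝓑 , x∈B , B⊆A) | inj₂ (B′ , B′∈𝓑 , x∈B′ , B′⊆A′) =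
  inj₂ (_ , ∩-closed B∈𝓑 B′∈𝓑 , (x∈B , x∈B′) , λ { (y∈B , y∈B′) → B⊆A y∈B , B′⊆A′ y∈B′ })
generated-local ∩-closed (union I F oF) (i , x∈F) with generated-local ∩-closed (oF i) x∈F
... | inj₁ all                   = inj₁ (λ y → i , all y)
... | inj₂ (B , B∈𝓑 , x∈B , B⊆F) = inj₂ (B , B∈𝓑 , x∈B , λ y∈B → i , B⊆F y∈B)

-- The sets whose trace on `H` is that of an open set of `τ` form a topology. Only traces are
-- compared, since the whole space is open in `τ ∣ H` even if it is not contained in `H`.
∣-open⁻ : (τ : Topology X) {H A : Pred X _} → Open (τ ∣ H) A →
          ∃[ W ] (Open τ W × A ∩ H ≐ W ∩ H)
∣-open⁻ τ (basic (V , oV , A⊆ , ⊇A)) =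
  V , oV , (λ { (x∈A , _) → A⊆ x∈A }) , (λ { (x∈V , x∈H) → ⊇A (x∈V , x∈H) , x∈H })
∣-open⁻ τ (resp (A⊆B , B⊆A) o) =
  let W , oW , A⊆W , W⊆A = ∣-open⁻ τ o
  in  W , oW , (λ { (x∈B , x∈H) → A⊆W (B⊆A x∈B , x∈H) })
      , (λ w → A⊆B (proj₁ (W⊆A w)) , proj₂ w)
∣-open⁻ τ whole = _ , Topology.whole τ , ≐-refl
∣-open⁻ τ (inter o o′) =
  let W  , oW  , A⊆W   , W⊆A   = ∣-open⁻ τ o
      W′ , oW′ , A′⊆W′ , W′⊆A′ = ∣-open⁻ τ o′
  in  W ∩ W′ , Topology.inter τ oW oW′
      , (λ { ((x∈A , x∈A′) , x∈H) → (proj₁ (A⊆W (x∈A , x∈H)) , proj₁ (A′⊆W′ (x∈A′ , x∈H))) , x∈H })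
      , (λ { ((x∈W , x∈W′) , x∈H) → (proj₁ (W⊆A (x∈W , x∈H)) , proj₁ (W′⊆A′ (x∈W′ , x∈H))) , x∈H })
∣-open⁻ τ {H} (union I F oF) =
  ⋃ I (λ i → proj₁ (rec i)) , Topology.union τ I _ (λ i → proj₁ (proj₂ (rec i)))
  , (λ { ((i , x∈F) , x∈H) → (i , proj₁ (proj₁ (proj₂ (proj₂ (rec i))) (x∈F , x∈H))) , x∈H })
  , (λ { ((i , x∈W) , x∈H) → (i , proj₁ (proj₂ (proj₂ (proj₂ (rec i))) (x∈W , x∈H))) , x∈H })
  where
  rec : ∀ i → ∃[ W ] (Open τ W × F i ∩ H ≐ W ∩ H)
  rec i = ∣-open⁻ τ (oF i)

-- Sequences in Noetherian topologies.

any-bounded : {I : Set a} {Q : Pred I b} (f : I → ℕ) {is : List I} →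
              Any Q is → Any (λ i → f i ≤ sum (map f is) × Q i) is
any-bounded f {i ∷ is} (here q)  = here (m≤m+n (f i) _ , q)
any-bounded f {i ∷ is} (there q) =
  there (Any.map (λ { (le , q′) → ≤-trans le (m≤n+m _ (f i)) , q′ }) (any-bounded f q))

-- A finite subfamily has indices bounded by their sum, so a point whose index is one larger than
-- the sum lies in a strictly earlier set.
noetherian⇒good : (τ : Topology X) → Noetherian τ →
  (F : ℕ → Pred X _) → (∀ n → Open τ (F n)) →
  (x : ℕ → X) → (∀ n → x n ∈ F n) → ∃[ m ] ∃[ n ] (m < n × x n ∈ F m)
noetherian⇒good {ℓ} τ noeth F oF x x∈F =
  let is , cover = noetherianOn τ noeth (Lift ℓ ℕ) (F ∘ lower) (oF ∘ lower)
      n = ℕ.suc (sum (map lower is))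
      lift m , m≤ , xn∈Fm = Any.satisfied (any-bounded lower (cover _ (lift n) (x∈F n)))
  in  m , n , s≤s m≤ , xn∈Fm

module _ {A : Set a} {_≲_ : A → A → Set b}
         (refl≲ : ∀ {x} → x ≲ x) (trans≲ : ∀ {x y z} → x ≲ y → y ≲ z → x ≲ z)
         (f : ℕ → A) (step : ∀ n → f n ≲ f (ℕ.suc n)) where

  ascending : ∀ {m n} → m ≤ n → f m ≲ f n
  ascending {n = ℕ.zero} z≤n = refl≲
  ascending {n = ℕ.suc n} m≤1+n with m≤n⇒m<n∨m≡n m≤1+n
  ... | inj₁ m<1+n = trans≲ (ascending (≤-pred m<1+n)) (step n)
  ... | inj₂ refl  = refl≲

⊆-ascending : (F : ℕ → Pred X a) → (∀ n → F n ⊆ F (ℕ.suc n)) → ∀ {m n} → m ≤ n → F m ⊆ F n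
⊆-ascending = ascending {_≲_ = λ A B → A ⊆ B} id (λ A⊆B B⊆C x∈A → B⊆C (A⊆B x∈A))

⊑-ascending : (τ : ℕ → Topology X) → (∀ n → τ n ⊑ τ (ℕ.suc n)) → ∀ {m n} → m ≤ n → τ m ⊑ τ n
⊑-ascending = ascending {_≲_ = _⊑_} id (λ σ⊑τ τ⊑υ o → τ⊑υ (σ⊑τ o))

-- Directed families of topologies.

Directed : Pred (Topology X) b → Set _
Directed P = ∀ {σ τ} → P σ → P τ → ∃[ ρ ] (P ρ × σ ⊑ ρ × τ ⊑ ρ)

-- The union of the topologies in `P`. If `P` is directed, it is closed under binary unions and
-- intersections, but infinite unions may leave it.
Basic : {X : Set ℓ} → Pred (Topology X) b → Pred (Pred X ℓ) _
Basic P A = ∃[ τ ] (P τ × Open τ A)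

module _ {X : Set ℓ} {P : Pred (Topology X) b} (directed : Directed P) where

  basic-∩ : ∀ {A B} → A ∈ Basic P → B ∈ Basic P → (A ∩ B) ∈ Basic P
  basic-∩ (σ , σ∈P , oA) (τ , τ∈P , oB) =
    let ρ , ρ∈P , σ⊑ρ , τ⊑ρ = directed σ∈P τ∈P
    in  ρ , ρ∈P , Topology.inter ρ (σ⊑ρ oA) (τ⊑ρ oB)

  basic-∪ : ∀ {A B} → A ∈ Basic P → B ∈ Basic P → (A ∪ B) ∈ Basic P
  basic-∪ (σ , σ∈P , oA) (τ , τ∈P , oB) =
    let ρ , ρ∈P , σ⊑ρ , τ⊑ρ = directed σ∈P τ∈P
    in  ρ , ρ∈P , ∪-open ρ (σ⊑ρ oA) (τ⊑ρ oB)

  basic-resp : ∀ {A B} → A ≐ B → A ∈ Basic P → B ∈ Basic P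
  basic-resp A≐B (τ , τ∈P , oA) = τ , τ∈P , Topology.resp τ A≐B oA

  basic-finite : (λ _ → ⊥) ∈ Basic P →
    {I : Set ℓ} {F : I → Pred X ℓ} → (∀ i → F i ∈ Basic P) →
    ∀ is → (λ x → Any (λ i → x ∈ F i) is) ∈ Basic P
  basic-finite ∅∈ F∈ []       = basic-resp ((λ ()) , λ ()) ∅∈
  basic-finite ∅∈ F∈ (i ∷ is) =
    basic-resp (Any.fromSum , Any.toSum) (basic-∪ (F∈ i) (basic-finite ∅∈ F∈ is))

-- Excluded middle holds for all types here, so it also chooses witnesses; and
-- True em is a copy of a proposition in the lowest universe.
module Classical (em : ∀ {a} → ExcludedMiddle a) where

  -- Classical tools: compactness from a basis and maximal open sets.

  dne : {A : Set a} → ¬ ¬ A → A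
  dne = decidable-stable em

  ⊈⇒∃ : {A B : Pred X a} → A ⊈ B → ∃[ x ] (x ∈ A × x ∉ B)
  ⊈⇒∃ A⊈B = dne (λ none → A⊈B (λ x∈A → dne (λ x∉B → none (_ , x∈A , x∉B))))

  -- Unless some `F i` is the whole space, each point of each `F i` has a basic neighbourhood inside
  -- `F i`. Finitely many of these cover all the others, and each is replaced by its `F i`.
  generated-noetherian :
    {𝓑 : Pred (Pred X _) _} → (∀ {A B} → A ∈ 𝓑 → B ∈ 𝓑 → (A ∩ B) ∈ 𝓑) →
    NoetherianOn 𝓑 U → Noetherian (generated 𝓑)
  generated-noetherian {X = X} {𝓑} ∩-closed noeth K I F oF K⊆F
    with em {P = ∃[ i ] (∀ y → y ∈ F i)}
  ... | yes (i , all) = i ∷ [] , λ _ → here (all _)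
  ... | no none =
    let js , cover = noeth J (proj₁ ∘ near) (proj₁ ∘ proj₂ ∘ near)
    in  map (proj₁ ∘ proj₂) js , λ {x} x∈K →
          let i , x∈F = K⊆F x∈K
              j = x , i , x∈F
          in  map⁺ (Any.map (λ {k} → proj₂ (proj₂ (proj₂ (near k))))
                (cover _ j (proj₁ (proj₂ (proj₂ (near j))))))
    where
    J : Set _
    J = ∃[ x ] ∃[ i ] (x ∈ F i)
    near : ((x , i , _) : J) → ∃[ B ] (B ∈ 𝓑 × x ∈ B × B ⊆ F i)
    near (x , i , x∈F) with generated-local ∩-closed (oF i) x∈F
    ... | inj₁ all = ⊥-elim (none (i , all))
    ... | inj₂ B   = B

  module _ {X : Set ℓ} (τ : Topology X) (noeth : Noetherian τ) (Q : Pred (Pred X ℓ) b) where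

    Maximal : Pred (Pred X ℓ) _
    Maximal B = Open τ B × Q B × (∀ C → Open τ C → Q C → B ⊆ C → C ⊆ B)

    -- Otherwise there is a strictly increasing sequence of open sets from `A` on, and the points
    -- new at each step contradict `noetherian⇒good`.
    maximal : ∀ {A} → Open τ A → Q A → ∃[ B ] (A ⊆ B × Maximal B)
    maximal {A} oA qA = dne contra
      where
      contra : ¬ ¬ (∃[ B ] (A ⊆ B × Maximal B))
      contra none =
        let m , n , m<n , x∈ = noetherian⇒good τ noeth (set ∘ ℕ.suc) (λ n → proj₁ (proj₂ (seq (ℕ.suc n))))
                                 (λ n → proj₁ (new n)) (λ n → proj₁ (proj₂ (new n)))
        in  proj₂ (proj₂ (new n)) (⊆-ascending set grows m<n x∈)
        where
        State : Set _
        State = ∃[ B ] (Open τ B × Q B × A ⊆ B)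
        Larger : Pred X ℓ → Set _
        Larger B = ∃[ C ] (Open τ C × Q C × B ⊆ C × C ⊈ B)
        larger : ((B , _) : State) → Larger B
        larger (B , oB , qB , A⊆B) = dne {A = Larger B} λ no-larger →
          none (B , A⊆B , oB , qB , λ C oC qC B⊆C → dne {A = C ⊆ B} λ C⊈B →
            no-larger (C , oC , qC , B⊆C , C⊈B))
        seq : ℕ → State
        seq ℕ.zero    = A , oA , qA , id
        seq (ℕ.suc n) =
          let C , oC , qC , B⊆C , _ = larger (seq n)
          in  C , oC , qC , λ x∈A → B⊆C (proj₂ (proj₂ (proj₂ (seq n))) x∈A)
        set : ℕ → Pred X ℓ
        set n = proj₁ (seq n)
        grows : ∀ n → set n ⊆ set (ℕ.suc n)
        grows n = proj₁ (proj₂ (proj₂ (proj₂ (larger (seq n)))))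
        new : ∀ n → ∃[ x ] (x ∈ set (ℕ.suc n) × x ∉ set n)
        new n = ⊈⇒∃ (proj₂ (proj₂ (proj₂ (proj₂ (larger (seq n))))))

  -- The family of remainders.

  module _ {X : Set ℓ} (τ : ℕ → Topology X) (V : ℕ → Pred X ℓ) where

    Remainder : Pred (Pred X ℓ) (lsuc ℓ)
    Remainder A = ∃[ n ] ∃[ W ] (Open (τ n) W × A ≐ W ∩ ∁ (V n))

    -- Both sets move to the larger level: `τ` increases, and removing the larger `V` also removes
    -- the smaller one.
    remainder-∩ : (∀ n → τ n ⊑ τ (ℕ.suc n)) → (∀ n → V n ⊆ V (ℕ.suc n)) →
                  ∀ {A B} → A ∈ Remainder → B ∈ Remainder → (A ∩ B) ∈ Remainder
    remainder-∩ τ-asc V-asc (m , W , oW , A⊆ , ⊇A) (n , W′ , oW′ , B⊆ , ⊇B) with ≤-total m n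
    ... | inj₁ m≤n =
      n , W ∩ W′ , Topology.inter (τ n) (⊑-ascending τ τ-asc m≤n oW) oW′
      , (λ { (x∈A , x∈B) → (proj₁ (A⊆ x∈A) , proj₁ (B⊆ x∈B)) , proj₂ (B⊆ x∈B) })
      , (λ { ((x∈W , x∈W′) , x∉V) →
             ⊇A (x∈W , λ x∈V → x∉V (⊆-ascending V V-asc m≤n x∈V)) , ⊇B (x∈W′ , x∉V) })
    ... | inj₂ n≤m =
      m , W ∩ W′ , Topology.inter (τ m) oW (⊑-ascending τ τ-asc n≤m oW′)
      , (λ { (x∈A , x∈B) → (proj₁ (A⊆ x∈A) , proj₁ (B⊆ x∈B)) , proj₂ (A⊆ x∈A) })
      , (λ { ((x∈W , x∈W′) , x∉V) →
             ⊇A (x∈W , x∉V) , ⊇B (x∈W′ , λ x∈V → x∉V (⊆-ascending V V-asc n≤m x∈V)) })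

    -- Fix a nonempty member W₀ ∩ ∁ Vₘ of the family.  Outside Vₘ ∪ W₀ the sets
    -- W ∪ Vₙ admit a finite subcover, and the sets W ∩ ∁ Vₙ do as well, except
    -- for members of finitely many levels, each of which is Noetherian.
    remainder-noetherian :
      (∀ n → Noetherian (τ n)) → (∀ n → Open (τ n) (V n)) → (∀ n → V n ⊆ V (ℕ.suc n)) →
      {𝓒 : Pred (Pred X ℓ) b} → (∀ n → Open (τ n) ⊆ 𝓒) →
      (∀ n W → Open (τ n) W → W ⊈ V n → NoetherianOn 𝓒 (∁ (V n ∪ W))) →
      NoetherianOn Remainder U
    remainder-noetherian noeth oV V-asc τ⊆𝓒 outside I F F∈
      with em {P = ∃[ i ] (proj₁ (proj₂ (F∈ i)) ⊈ V (proj₁ (F∈ i)))}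
    ... | no none = [] , λ _ i x∈F →
      let n , W , oW , F⊆ , _ = F∈ i
          x∈W , x∉V = F⊆ x∈F
      in  ⊥-elim (none (i , λ W⊆V → x∉V (W⊆V x∈W)))
    ... | yes (i₀ , W₀⊈V) = i₀ ∷ proj₁ far ++ proj₁ (upTo bound) , cover
      where
      lvl : I → ℕ
      lvl i = proj₁ (F∈ i)
      W : I → Pred X ℓ
      W i = proj₁ (proj₂ (F∈ i))
      oW : ∀ i → Open (τ (lvl i)) (W i)
      oW i = proj₁ (proj₂ (proj₂ (F∈ i)))
      ∈F⁺ : ∀ {x} i → x ∈ W i → x ∉ V (lvl i) → x ∈ F i
      ∈F⁺ i x∈W x∉V = proj₂ (proj₂ (proj₂ (proj₂ (F∈ i)))) (x∈W , x∉V)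
      ∈F⁻ : ∀ {x} i → x ∈ F i → x ∈ W i × x ∉ V (lvl i)
      ∈F⁻ i = proj₁ (proj₂ (proj₂ (proj₂ (F∈ i))))

      far : ∃[ is ] (∀ {x} → x ∈ ∁ (V (lvl i₀) ∪ W i₀) → ∀ i → x ∈ W i ∪ V (lvl i) →
                     Any (λ j → x ∈ W j ∪ V (lvl j)) is)
      far = outside (lvl i₀) (W i₀) (oW i₀) W₀⊈V I (λ i → W i ∪ V (lvl i))
              (λ i → τ⊆𝓒 (lvl i) (∪-open (τ (lvl i)) (oW i) (oV (lvl i))))

      level : ∀ n → ∃[ is ] (∀ {x} i → lvl i ≡ n → x ∈ F i → Any (λ j → x ∈ F j) is)
      level n =
        let js , cov = noetherianOn (τ n) (noeth n) (∃[ i ] (lvl i ≡ n)) (W ∘ proj₁)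
                         (λ { (i , refl) → oW i })
        in  map proj₁ js , λ { i refl x∈F →
              let x∈W , x∉V = ∈F⁻ i x∈F
              in  map⁺ (Any.map (λ { {j , eq} x∈Wj → ∈F⁺ j x∈Wj (λ x∈V → x∉V (shift eq x∈V)) })
                    (cov _ (i , refl) x∈W)) }
        where
        shift : ∀ {m n} → m ≡ n → V m ⊆ V n
        shift refl = id

      upTo : ∀ n → ∃[ is ] (∀ {x} i → lvl i < n → x ∈ F i → Any (λ j → x ∈ F j) is)
      upTo ℕ.zero    = [] , λ _ ()
      upTo (ℕ.suc n) = proj₁ (level n) ++ proj₁ (upTo n) , λ i i<1+n x∈F →
        [ (λ i<n → ++⁺ʳ (proj₁ (level n)) (proj₂ (upTo n) i i<n x∈F))
        , (λ i≡n → ++⁺ˡ (proj₂ (level n) i i≡n x∈F))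
        ]′ (m≤n⇒m<n∨m≡n (≤-pred i<1+n))

      -- At least `lvl i₀` and every level in `far`, so a point of an `F i` of level `bound` or more
      -- avoids all the sets `V` of those levels.
      bound : ℕ
      bound = lvl i₀ ℕ.+ sum (map lvl (proj₁ far))

      above : ∀ {x} i → x ∈ F i → bound ≤ lvl i → ∀ {m} → m ≤ bound → x ∉ V m
      above i x∈F bound≤ m≤ x∈V =
        proj₂ (∈F⁻ i x∈F) (⊆-ascending V V-asc (≤-trans m≤ bound≤) x∈V)

      cover : ∀ {x} → x ∈ U → ∀ i → x ∈ F i →
              Any (λ j → x ∈ F j) (i₀ ∷ proj₁ far ++ proj₁ (upTo bound))
      cover {x} _ i x∈F with bound ≤? lvl i | em {P = x ∈ W i₀}
      ... | no bound≰  | _        = there (++⁺ʳ (proj₁ far) (proj₂ (upTo bound) i (≰⇒> bound≰) x∈F))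
      ... | yes bound≤ | yes x∈W₀ = here (∈F⁺ i₀ x∈W₀ (above i x∈F bound≤ (m≤m+n _ _)))
      ... | yes bound≤ | no x∉W₀  = there (++⁺ˡ (Any.map
        (λ { {j} (j≤ , inj₁ x∈W) → ∈F⁺ j x∈W (outside-V (≤-trans j≤ (m≤n+m _ (lvl i₀))))
           ; (j≤ , inj₂ x∈V) → ⊥-elim (outside-V (≤-trans j≤ (m≤n+m _ (lvl i₀))) x∈V) })
        (any-bounded lvl
          (proj₂ far [ outside-V (m≤m+n _ _) , x∉W₀ ]′ i (inj₁ (proj₁ (∈F⁻ i x∈F)))))))
        where
        outside-V : ∀ {m} → m ≤ bound → x ∉ V m
        outside-V = above i x∈F bound≤

  -- Suprema of topologies.

  -- `Basic P` quantifies over topologies and so lies one universe too high for `generated`;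
  -- `True em` brings it down.
  ⋁ : {X : Set ℓ} → (Topology X → Set) → Topology X
  ⋁ {ℓ} P = generated (λ A → Lift (lsuc ℓ) (True (em {P = Basic P A})))

  module _ {X : Set ℓ} {P : Topology X → Set} where

    ⋁-upper : ∀ {τ} → P τ → τ ⊑ ⋁ P
    ⋁-upper τ∈P oA = basic (lift (fromWitness (_ , τ∈P , oA)))

    ⋁-least : ∀ σ → (∀ τ → P τ → τ ⊑ σ) → ⋁ P ⊑ σ
    ⋁-least σ upper = generated-⊑ σ λ { (lift A∈) →
      let τ , τ∈P , oA = toWitness A∈ in upper τ τ∈P oA }

    module _ (directed : Directed P) where

      private
        ∩-closed : ∀ {A B} → Lift (lsuc ℓ) (True (em {P = Basic P A})) →
                   Lift (lsuc ℓ) (True (em {P = Basic P B})) →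
                   Lift (lsuc ℓ) (True (em {P = Basic P (A ∩ B)}))
        ∩-closed (lift A∈) (lift B∈) =
          lift (fromWitness (basic-∩ directed (toWitness A∈) (toWitness B∈)))

      ⋁-noetherian : NoetherianOn (Basic P) U → Noetherian (⋁ P)
      ⋁-noetherian noeth = generated-noetherian ∩-closed λ I F F∈ →
        noeth I F (λ i → toWitness (lower (F∈ i)))

      -- By compactness `A` is a finite union of basic sets, hence basic. The point `x` provides a
      -- member of `P`, where the empty union is open, and `y` rules out that `A` is the whole
      -- space.
      ⋁-open⁻ : Noetherian (⋁ P) → ∀ {A} → Open (⋁ P) A →
                ∀ {x y} → x ∈ A → y ∉ A → A ∈ Basic P
      ⋁-open⁻ noeth {A} oA {x} {y} x∈A y∉A =
        let is , cov = noetherianOn (⋁ P) noeth (∃[ z ] (z ∈ A)) (proj₁ ∘ near)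
                         (λ i → let σ , σ∈P , oB = proj₁ (proj₂ (near i)) in ⋁-upper σ∈P oB)
            τ , τ∈P , _ = proj₁ (proj₂ (near (x , x∈A)))
        in  basic-resp directed
              ( (λ z∈ → let i , z∈B = Any.satisfied z∈ in proj₂ (proj₂ (proj₂ (near i))) z∈B)
              , (λ {z} z∈A → cov _ (z , z∈A) (proj₁ (proj₂ (proj₂ (near (z , z∈A)))))) )
              (basic-finite directed (τ , τ∈P , ∅-open τ) (λ i → proj₁ (proj₂ (near i))) is)
        where
        near : ((z , _) : ∃[ z ] (z ∈ A)) → ∃[ B ] (B ∈ Basic P × z ∈ B × B ⊆ A)
        near (z , z∈A) with generated-local ∩-closed oA z∈A
        ... | inj₁ all = ⊥-elim (y∉A (all y))
        ... | inj₂ (B , lift B∈ , z∈B , B⊆A) = B , toWitness B∈ , z∈B , B⊆A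

  -- The transfinite iteration of `R`.

  module _ {X : Set ℓ} {R : Topology X → Topology X} (expander : IsTopologyExpander R) where

    open IsTopologyExpander expander

    -- The iteration starts at `sup` of the empty family, the coarsest topology.
    data Stage : Topology X → Set (lsuc (lsuc ℓ)) where
      next : ∀ {τ} → Stage τ → Stage (R τ)
      sup  : (P : Topology X → Set) → (∀ τ → P τ → Stage τ) → Stage (⋁ P)

    stage-⊑-R : ∀ {τ} → Stage τ → τ ⊑ R τ
    stage-⊑-R (next t)  = monotone _ _ (stage-⊑-R t)
    stage-⊑-R (sup P t) = ⋁-least (R (⋁ P)) λ τ τ∈P oA →
      monotone τ (⋁ P) (⋁-upper τ∈P) (stage-⊑-R (t τ τ∈P) oA)

    -- The second alternative is one step stronger than `τ ⊑ σ`, as in the Bourbaki-Witt theorem, so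
    -- that the two stages can exchange roles in the successor case.
    compare : ∀ {σ τ} → Stage σ → Stage τ → σ ⊑ τ ⊎ R τ ⊑ σ
    compare (next s) t with compare t s
    ... | inj₁ τ⊑σ  = inj₂ (monotone _ _ τ⊑σ)
    ... | inj₂ Rσ⊑τ = inj₁ Rσ⊑τ
    compare {τ = τ} (sup P s) t with em {P = ∃[ σ ] (P σ × R τ ⊑ σ)}
    ... | yes (σ , σ∈P , Rτ⊑σ) = inj₂ (λ oA → ⋁-upper σ∈P (Rτ⊑σ oA))
    ... | no none = inj₁ (⋁-least τ below)
      where
      below : ∀ σ → P σ → σ ⊑ τ
      below σ σ∈P with compare (s σ σ∈P) t
      ... | inj₁ σ⊑τ  = σ⊑τ
      ... | inj₂ Rτ⊑σ = ⊥-elim (none (σ , σ∈P , Rτ⊑σ))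

    stages-directed : {P : Topology X → Set} → (∀ τ → P τ → Stage τ) → Directed P
    stages-directed stage {σ} {τ} σ∈P τ∈P with compare (stage σ σ∈P) (stage τ τ∈P)
    ... | inj₁ σ⊑τ  = τ , τ∈P , σ⊑τ , id
    ... | inj₂ Rτ⊑σ = σ , σ∈P , id , λ oA → Rτ⊑σ (stage-⊑-R (stage τ τ∈P) oA)

    -- This plays the role of choosing an open set of minimal ordinal rank.
    first-stage : (Q : Pred (Pred X ℓ) b) →
      (∀ {A} → Q A → (∃[ x ] (x ∈ A)) × (∃[ y ] (y ∉ A))) →
      ∀ {τ A} → Stage τ → Noetherian τ → Open τ A → Q A →
      ∃[ σ ] (Stage σ × R σ ⊑ τ × (∃[ B ] (Open (R σ) B × Q B)) × (∀ B → Open σ B → ¬ Q B))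
    first-stage Q proper (next {τ} t) noeth oA qA with em {P = ∃[ B ] (Open τ B × Q B)}
    ... | no none = τ , t , id , (_ , oA , qA) , λ B oB qB → none (B , oB , qB)
    ... | yes (B , oB , qB) =
      let τ⊑Rτ = stage-⊑-R t
          σ , s , Rσ⊑τ , found , none =
            first-stage Q proper t (⊑-noetherian τ (R τ) τ⊑Rτ noeth) oB qB
      in  σ , s , (λ o → τ⊑Rτ (Rσ⊑τ o)) , found , none
    first-stage Q proper (sup P t) noeth oA qA =
      let (x , x∈A) , (y , y∉A) = proper qA
          -- `A` is already open in a member of the family, so no set satisfying `Q` first appears
          -- at a supremum.
          τ , τ∈P , oA′ = ⋁-open⁻ (stages-directed t) noeth oA x∈A y∉A
          σ , s , Rσ⊑τ , found , none =
            first-stage Q proper (t τ τ∈P)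
              (⊑-noetherian τ (⋁ P) (⋁-upper τ∈P) noeth) oA′ qA
      in  σ , s , (λ o → ⋁-upper τ∈P (Rσ⊑τ o)) , found , none

    -- The bad sequence argument.

    -- The property negated in the conclusion is what maximality of `V n` provides: adjoining any
    -- new set `W` open in `τ n` leaves a good complement.
    no-badSequence :
      (τ : ℕ → Topology X) (V : ℕ → Pred X ℓ) →
      (∀ n → Noetherian (τ n)) → (∀ n → τ n ⊑ R (τ n)) → (∀ n → τ n ⊑ τ (ℕ.suc n)) →
      (∀ n → Open (τ n) (V n)) → (∀ n → Open (R (τ n)) (V (ℕ.suc n))) →
      (∀ n → V n ⊆ V (ℕ.suc n)) → (∀ n → V (ℕ.suc n) ⊈ V n) →
      {𝓒 : Pred (Pred X ℓ) b} → (∀ n → Open (τ n) ⊆ 𝓒) →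
      ¬ (∀ n W → Open (τ n) W → W ⊈ V n → NoetherianOn 𝓒 (∁ (V n ∪ W)))
    no-badSequence τ V τ-noeth τ⊑Rτ τ-asc V-open V-next V-asc strict τ⊆𝓒 outside =
      let m , n , m<n , x∈W =
            noetherian⇒good (R σ) (noetherian σ σ-noeth) (proj₁ ∘ trace) (proj₁ ∘ proj₂ ∘ trace)
              (proj₁ ∘ new) (λ n → proj₁ (proj₁ (proj₂ (proj₂ (trace n))) (proj₂ (new n))))
          x∉V = proj₂ (proj₂ (new n))
      -- Outside `V m` the `m`-th trace agrees with `V (ℕ.suc m)`, which is contained in `V n`,
      -- whereas the `n`-th point is outside `V n`.
      in  x∉V (⊆-ascending V V-asc m<n (proj₁ (proj₂ (proj₂ (proj₂ (trace m)))
            (x∈W , λ x∈Vm → x∉V (⊆-ascending V V-asc (<⇒≤ m<n) x∈Vm)))))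
      where
      new : ∀ n → ∃[ x ] (x ∈ V (ℕ.suc n) × x ∉ V n)
      new n = ⊈⇒∃ (strict n)

      σ : Topology X
      σ = generated (Remainder τ V)

      σ-noeth : Noetherian σ
      σ-noeth = generated-noetherian (remainder-∩ τ V τ-asc V-asc)
        (remainder-noetherian τ V τ-noeth V-open V-asc τ⊆𝓒 outside)

      trace : ∀ n → ∃[ W ] (Open (R σ) W × V (ℕ.suc n) ∩ ∁ (V n) ≐ W ∩ ∁ (V n))
      trace n =
        let H = ∁ (V n)
            closed = Topology.resp (τ n) ((λ x∈V x∉V → x∉V x∈V) , dne) (V-open n)
            -- The expander property moves the restriction inside `R`; each `τ n ∣ H` is coarser
            -- than `σ`, so `R σ` serves all `n` at once.
            W , oW , ⊆W , W⊆ = ∣-open⁻ (R (τ n ∣ H))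
              (proj₁ (restriction (τ n) (τ-noeth n) (τ⊑Rτ n) H closed)
                (basic (V (ℕ.suc n) , V-next n , ≐-refl)))
        in  W
            , monotone (τ n ∣ H) σ
                (generated-⊑ σ λ { (W , oW , A≐W) → basic (n , W , oW , A≐W) }) oW
            , (λ { (x∈V , x∈H) → ⊆W ((x∈V , x∈H) , x∈H) })
            , (λ w → proj₁ (W⊆ w))

    -- Suprema of Noetherian stages.

    module Limit (P : Topology X → Set) (stage : ∀ τ → P τ → Stage τ)
                 (noeth : ∀ τ → P τ → Noetherian τ) where

      directed : Directed P
      directed = stages-directed stage

      Bad : Pred (Pred X ℓ) (lsuc (lsuc ℓ))
      Bad V = ¬ NoetherianOn (Basic P) (∁ V)

      bad⇒∃∉ : ∀ {V} → Bad V → ∃[ y ] (y ∉ V)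
      bad⇒∃∉ bad = dne λ none → bad λ I F F∈ → [] , λ x∉V → ⊥-elim (none (_ , x∉V))

      BadAbove : Pred X ℓ → Pred (Pred X ℓ) (lsuc (lsuc ℓ))
      BadAbove V A = V ⊆ A × A ⊈ V × Bad A

      -- If adjoining some `F i` not inside `V` gave a good set, then a finite subfamily for the
      -- complement of `V ∪ F i`, together with `F i`, would do for the complement of `V`.
      enlarge : ∀ {V} → V ∈ Basic P → Bad V → ∃[ A ] (A ∈ Basic P × BadAbove V A)
      enlarge {V} V∈ bad = dne λ none → bad λ I F F∈ → finite none F F∈ em
        where
        finite : ¬ (∃[ A ] (A ∈ Basic P × BadAbove V A)) →
                 {I : Set ℓ} (F : I → Pred X ℓ) → (∀ i → F i ∈ Basic P) →
                 Dec (∃[ i ] (F i ⊈ V)) →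
                 ∃[ is ] (∀ {x} → x ∈ ∁ V → ∀ i → x ∈ F i → Any (λ j → x ∈ F j) is)
        finite none F F∈ (no all⊆V) =
          [] , λ x∉V i x∈F → ⊥-elim (all⊆V (i , λ F⊆V → x∉V (F⊆V x∈F)))
        finite none {I} F F∈ (yes (i , F⊈V)) = i ∷ proj₁ rest , cover
          where
          rest : ∃[ is ] (∀ {x} → x ∈ ∁ (V ∪ F i) → ∀ j → x ∈ F j → Any (λ k → x ∈ F k) is)
          rest = dne (λ V∪F-bad → none (V ∪ F i , basic-∪ directed V∈ (F∈ i) , inj₁
                   , (λ V∪F⊆V → F⊈V (λ x∈F → V∪F⊆V (inj₂ x∈F))) , V∪F-bad)) I F F∈
          cover : ∀ {x} → x ∈ ∁ V → ∀ j → x ∈ F j → Any (λ k → x ∈ F k) (i ∷ proj₁ rest)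
          cover {x} x∉V j x∈F with em {P = x ∈ F i}
          ... | yes x∈Fi = here x∈Fi
          ... | no x∉Fi  = there (proj₂ rest [ x∉V , x∉Fi ]′ j x∈F)

      -- The stage `ρ` may lie outside `P`; the member `bound` above it puts the open sets of `ρ`
      -- into `Basic P`.
      record MaximalBad (ρ : Topology X) : Set (lsuc (lsuc ℓ)) where
        field
          stageρ  : Stage ρ
          {bound} : Topology X
          bound∈P : P bound
          ρ⊑bound : ρ ⊑ bound
          V       : Pred X ℓ
          V-open  : Open ρ V
          V-bad   : Bad V
          V-max   : ∀ A → Open ρ A → ¬ BadAbove V A

      maximalBad : ∀ {τ ρ A} → P τ → ρ ⊑ τ → Stage ρ → Open ρ A → Bad A →
                   Σ (MaximalBad ρ) λ s → A ⊆ MaximalBad.V s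
      maximalBad {τ} {ρ} τ∈P ρ⊑τ s oA bad =
        let V , A⊆V , V-open , V-bad , V-max =
              maximal ρ (⊑-noetherian ρ τ ρ⊑τ (noeth τ τ∈P)) Bad oA bad
        in  record { stageρ = s ; bound∈P = τ∈P ; ρ⊑bound = ρ⊑τ
                   ; V = V ; V-open = V-open ; V-bad = V-bad
                   ; V-max = λ C oC (V⊆C , C⊈V , C-bad) → C⊈V (V-max C oC C-bad V⊆C) }
            , A⊆V

      -- `V` stays maximal up to `σ`, and strictly larger bad sets first appear in `R σ`. These `σ`
      -- become the topologies of the bad sequence.
      record Extension {ρ} (s : MaximalBad ρ) : Set (lsuc (lsuc ℓ)) where
        open MaximalBad s
        field
          {σ}     : Topology X
          ρ⊑σ     : ρ ⊑ σ
          σ⊑Rσ    : σ ⊑ R σ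
          σ-noeth : Noetherian σ
          σ-max   : ∀ A → Open σ A → ¬ BadAbove V A
          after   : MaximalBad (R σ)
          grows   : V ⊆ MaximalBad.V after
          strict  : MaximalBad.V after ⊈ V

      extend : ∀ {ρ} (s : MaximalBad ρ) → Extension s
      extend s =
        let open MaximalBad s
            A , (τ , τ∈P , oA) , A-above = enlarge (bound , bound∈P , ρ⊑bound V-open) V-bad
            σ , σ-stage , Rσ⊑τ , (B , oB , V⊆B , B⊈V , B-bad) , σ-max =
              first-stage (BadAbove V)
                (λ (V⊆A , A⊈V , A-bad) → (let x , x∈A , _ = ⊈⇒∃ A⊈V in x , x∈A) , bad⇒∃∉ A-bad)
                (stage τ τ∈P) (noeth τ τ∈P) oA A-above
            after , B⊆ = maximalBad τ∈P Rσ⊑τ (next σ-stage) oB B-bad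
        in  record
              -- Were `R σ` below `ρ`, then `B` would be open in `ρ`, against the maximality of `V`.
              { ρ⊑σ     = [ id , (λ Rσ⊑ρ → ⊥-elim (V-max B (Rσ⊑ρ oB) (V⊆B , B⊈V , B-bad))) ]′
                            (compare stageρ σ-stage)
              ; σ⊑Rσ    = stage-⊑-R σ-stage
              ; σ-noeth = ⊑-noetherian σ τ (λ o → Rσ⊑τ (stage-⊑-R σ-stage o)) (noeth τ τ∈P)
              ; σ-max   = σ-max
              ; after   = after
              ; grows   = λ x∈V → B⊆ (V⊆B x∈V)
              ; strict  = λ ⊆V → B⊈V (λ x∈B → ⊆V (B⊆ x∈B))
              }

      no-maximalBad : ∀ {ρ₀} → ¬ MaximalBad ρ₀
      no-maximalBad {ρ₀} s₀ =
        no-badSequence E.σ M.V E.σ-noeth E.σ⊑Rσ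
          -- The stages interlock: `R (E.σ n)` is the `ρ` of the next state, hence lies below
          -- `E.σ (ℕ.suc n)`.
          (λ n o → E.ρ⊑σ (ℕ.suc n) (E.σ⊑Rσ n o))
          (λ n → E.ρ⊑σ n (M.V-open n)) (λ n → M.V-open (ℕ.suc n)) E.grows E.strict
          {𝓒 = Basic P}
          (λ n oA → _ , M.bound∈P (ℕ.suc n) , M.ρ⊑bound (ℕ.suc n) (E.σ⊑Rσ n oA))
          (λ n W oW W⊈V → dne λ bad →
            E.σ-max n (M.V n ∪ W) (∪-open (E.σ n) (E.ρ⊑σ n (M.V-open n)) oW)
              (inj₁ , (λ V∪W⊆V → W⊈V (λ x∈W → V∪W⊆V (inj₂ x∈W))) , bad))
        where
        state : ℕ → Σ (Topology X) MaximalBad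
        state ℕ.zero    = ρ₀ , s₀
        state (ℕ.suc n) = _ , Extension.after (extend (proj₂ (state n)))

        module M n = MaximalBad (proj₂ (state n))
        module E n = Extension (extend (proj₂ (state n)))

      limit-noetherian : Noetherian (⋁ P)
      limit-noetherian = ⋁-noetherian directed (dne {A = NoetherianOn (Basic P) U} λ bad →
        -- An empty `P` has no basic sets, so badness supplies a member of `P`; the sequence starts
        -- there from the empty set, whose complement is the whole space.
        let τ , τ∈P = dne {A = Σ _ P} λ empty → bad λ I F F∈ → [] , λ _ i _ →
                        ⊥-elim (empty (_ , proj₁ (proj₂ (F∈ i))))
        in  no-maximalBad (proj₁ (maximalBad {τ} {τ} τ∈P id (stage τ τ∈P) (∅-open τ) λ noeth →
              bad λ I F F∈ → let is , cover = noeth I F F∈ in is , λ _ → cover λ ())))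

    -- The least fixed point.

    stage-noetherian : ∀ {τ} → Stage τ → Noetherian τ
    stage-noetherian (next {τ} t)    = noetherian τ (stage-noetherian t)
    stage-noetherian (sup P stage) =
      Limit.limit-noetherian P stage (λ τ τ∈P → stage-noetherian (stage τ τ∈P))

    stage-least : ∀ {τ} σ → R σ ⊑ σ → Stage τ → τ ⊑ σ
    stage-least σ Rσ⊑σ (next t) oA = Rσ⊑σ (monotone _ σ (stage-least σ Rσ⊑σ t) oA)
    stage-least σ Rσ⊑σ (sup P t)   = ⋁-least σ λ τ τ∈P → stage-least σ Rσ⊑σ (t τ τ∈P)

    -- The supremum of all stages is a stage, as `True em` makes the class of stages an admissible
    -- argument of `sup`. Hence `R μ` is a stage too, and so lies below `μ`.
    μ : Topology X
    μ = ⋁ (λ τ → True (em {P = Stage τ}))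

    μ-stage : Stage μ
    μ-stage = sup _ (λ _ → toWitness)

    μ-isLeastFixedPoint : IsLeastFixedPoint R μ
    μ-isLeastFixedPoint = record
      { fixed = ⋁-upper (fromWitness (next μ-stage)) , stage-⊑-R μ-stage
      ; least = λ σ (Rσ⊑σ , _) → stage-least σ Rσ⊑σ μ-stage
      }

mainTheorem1 : (∀ {a} → ExcludedMiddle a) →
    ∀ {ℓ} (X : Set ℓ) (R : Topology X → Topology X) →
    IsTopologyExpander R →
    ∃[ μ ] (IsLeastFixedPoint R μ × Noetherian μ)
mainTheorem1 em X R expander =
  μ expander , μ-isLeastFixedPoint expander , stage-noetherian expander (μ-stage expander)
  where open Classical em
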